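{- Let $\mathbf{A}$ be a normal and quasicomplemented distributive nearlattice. Then every prime $\alpha$-ideal of $A$ is a maximal ideal.
   Context: A distributive nearlattice is a join-semilattice $\langle A,\vee,1\rangle$ with greatest element $1$ in which every principal filter $[a)=\{x\in A\colon a\le x\}$ is a bounded distributive lattice. An ideal of $A$ is a subset $I$ that is downward closed and closed under $\vee$. A prime ideal is a non-empty proper ideal $P$ such that $a\wedge b\in P$ implies $a\in P$ or $b\in P$ whenever $a\wedge b$ exists. A maximal ideal is a non-empty proper ideal $I$ such that for every ideal $J\supseteq I$, $J=I$ or $J=A$. For $a\in A$, $a^{\top}=\{x\in A\colon x\vee a=1\}$ and $a^{\top\top}=\{y\in A\colon y\vee x=1\text{ for all }x\in a^{\top}\}$. An ideal $I$ is an $\alpha$-ideal if for each $a\in A$, $I\cap a^{\top\top}\ne\emptyset$ implies $a\in I$. $\mathbf{A}$ is normal if each prime ideal is contained in a unique maximal ideal. $\mathbf{A}$ is quasicomplemented if for each $a\in A$ there exists $b\in A$ with $a^{\top\top}=b^{\top}$. -}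

module Defs where

open import Level using (Level; suc; _⊔_)
open import Data.Product using (Σ; ∃; _×_; _,_)
open import Data.Sum using (_⊎_)
open import Relation.Nullary using (¬_)
open import Relation.Binary.PropositionalEquality using (_≡_)
open import Relation.Unary using (Pred; _∈_; _∉_; _⊆_)

-- A join-semilattice ⟨A, ∨, 1⟩ with greatest element 1, with order
-- x ≤ y :⟺ x ∨ y ≡ y, such that every principal filter [a) is a
-- bounded distributive lattice (bottom a, top 1, join ∨, meets exist).
record DistNearlattice (ℓ : Level) : Set (suc ℓ) where
  infixl 6 _∨_
  infix 4 _≤_
  field
    Carrier : Set ℓ
    _∨_     : Carrier → Carrier → Carrier
    𝟏       : Carrier
    ∨-assoc : ∀ x y z → (x ∨ y) ∨ z ≡ x ∨ (y ∨ z)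
    ∨-comm  : ∀ x y → x ∨ y ≡ y ∨ x
    ∨-idem  : ∀ x → x ∨ x ≡ x
    ∨-top   : ∀ x → x ∨ 𝟏 ≡ 𝟏

  _≤_ : Carrier → Carrier → Set ℓ
  x ≤ y = x ∨ y ≡ y

  IsMeetIn : Carrier → Carrier → Carrier → Carrier → Set ℓ
  IsMeetIn a m x y =
    a ≤ m × m ≤ x × m ≤ y × (∀ z → a ≤ z → z ≤ x → z ≤ y → z ≤ m)

  field
    filter-meet : ∀ a x y → a ≤ x → a ≤ y → Σ Carrier (λ m → IsMeetIn a m x y)
    filter-distrib : ∀ a x y z m₁ m₂ m₃ → a ≤ x → a ≤ y → a ≤ z →
      IsMeetIn a m₁ x (y ∨ z) → IsMeetIn a m₂ x y → IsMeetIn a m₃ x z →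
      m₁ ≡ m₂ ∨ m₃

  -- m is the meet a ∧ b in A (so "a ∧ b exists" means Σ m, IsMeet m a b)
  IsMeet : Carrier → Carrier → Carrier → Set ℓ
  IsMeet m x y = m ≤ x × m ≤ y × (∀ z → z ≤ x → z ≤ y → z ≤ m)

  Subset : Set (suc ℓ)
  Subset = Pred Carrier ℓ

  _≐_ : Subset → Subset → Set ℓ
  I ≐ J = I ⊆ J × J ⊆ I

  IsIdeal : Subset → Set ℓ
  IsIdeal I = (∀ {x y} → x ≤ y → y ∈ I → x ∈ I)
            × (∀ {x y} → x ∈ I → y ∈ I → (x ∨ y) ∈ I)

  NonEmpty : Subset → Set ℓ
  NonEmpty I = Σ Carrier (λ x → x ∈ I)

  Proper : Subset → Set ℓ
  Proper I = ¬ (∀ x → x ∈ I)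

  IsPrimeIdeal : Subset → Set ℓ
  IsPrimeIdeal P = IsIdeal P × NonEmpty P × Proper P
    × (∀ a b m → IsMeet m a b → m ∈ P → a ∈ P ⊎ b ∈ P)

  IsMaximalIdeal : Subset → Set (suc ℓ)
  IsMaximalIdeal I = IsIdeal I × NonEmpty I × Proper I
    × (∀ (J : Subset) → IsIdeal J → I ⊆ J → (J ≐ I) ⊎ (∀ x → x ∈ J))

  _^⊤ : Carrier → Subset
  (a ^⊤) x = x ∨ a ≡ 𝟏

  _^⊤⊤ : Carrier → Subset
  (a ^⊤⊤) y = ∀ x → x ∈ (a ^⊤) → y ∨ x ≡ 𝟏

  IsαIdeal : Subset → Set ℓ
  IsαIdeal I = IsIdeal I ×
    (∀ a → Σ Carrier (λ x → x ∈ I × x ∈ (a ^⊤⊤)) → a ∈ I)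

  IsNormal : Set (suc ℓ)
  IsNormal = ∀ (P : Subset) → IsPrimeIdeal P →
    Σ Subset (λ M → IsMaximalIdeal M × P ⊆ M ×
      (∀ (M' : Subset) → IsMaximalIdeal M' → P ⊆ M' → M' ≐ M))

  IsQuasicomplemented : Set ℓ
  IsQuasicomplemented = ∀ a → Σ Carrier (λ b → (a ^⊤⊤) ≐ (b ^⊤))

{-# OPTIONS --safe #-}

-- Let P be a prime α-ideal and p ∈ P.  If a^⊤ ∩ b^⊤ ⊆ p^⊤, then a ∈ P or b ∈ P:
-- the meet d of p ∨ a and p ∨ b in [p) satisfies d^⊤ ⊆ p^⊤, because z ∨ d = 1
-- puts z ∨ p in a^⊤ ∩ b^⊤; so d ∈ P as P is an α-ideal, and P is prime.  A
-- quasicomplement b of a satisfies a^⊤ ∩ b^⊤ = a^⊤ ∩ a^⊤⊤ = {1}, so a ∈ P or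
-- b ∈ P.  If a lies in a proper ideal M ⊇ P, then b ∉ M since a ∨ b = 1, hence
-- a ∈ P; thus P = M.

module Submission where

open import Defs
open import Level using (Level)
open import Algebra.Lattice.Bundles using (Semilattice)
open import Data.Product using (∃-syntax; _,_)
open import Data.Sum using (_⊎_; fromInj₁; map; map₁)
open import Function using (_∘_)
open import Relation.Binary.Definitions using (_Respects_)
open import Relation.Binary.Lattice using (JoinSemilattice)
open import Relation.Binary.PropositionalEquality using (_≡_; sym; trans; cong; cong₂; subst; isEquivalence; module ≡-Reasoning)
open import Relation.Nullary using (contradiction)
open import Relation.Unary using (_∈_; _∉_; _⊆_; _∩_; ｛_｝)
import Algebra.Lattice.Properties.Semilattice as SemilatticeProperties

module _ {ℓ : Level} (A : DistNearlattice ℓ) where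
  open DistNearlattice A
  open ≡-Reasoning

  ∨-semilattice : Semilattice ℓ ℓ
  ∨-semilattice = record
    { isSemilattice = record
      { isBand = record
        { isSemigroup = record
          { isMagma = record { isEquivalence = isEquivalence ; ∙-cong = cong₂ _∨_ }
          ; assoc   = ∨-assoc
          }
        ; idem = ∨-idem
        }
      ; comm = ∨-comm
      }
    }

  -- The standard library orders a semilattice by y ≡ y ∨ x rather than x ∨ y ≡ y.
  open JoinSemilattice (SemilatticeProperties.∧-orderTheoreticJoinSemilattice ∨-semilattice)
    using () renaming
      (_≤_ to _⊑_; trans to ⊑-trans; x≤x∨y to x⊑x∨y; y≤x∨y to y⊑x∨y; ∨-least to ⊑-∨-least)

  ≤⇒⊑ : ∀ {x y} → x ≤ y → x ⊑ y
  ≤⇒⊑ {x} {y} x≤y = trans (sym x≤y) (∨-comm x y)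

  ⊑⇒≤ : ∀ {x y} → x ⊑ y → x ≤ y
  ⊑⇒≤ {x} {y} x⊑y = trans (∨-comm x y) (sym x⊑y)

  ≤-trans : ∀ {x y z} → x ≤ y → y ≤ z → x ≤ z
  ≤-trans x≤y y≤z = ⊑⇒≤ (⊑-trans (≤⇒⊑ x≤y) (≤⇒⊑ y≤z))

  x≤x∨y : ∀ x y → x ≤ x ∨ y
  x≤x∨y x y = ⊑⇒≤ (x⊑x∨y x y)

  y≤x∨y : ∀ x y → y ≤ x ∨ y
  y≤x∨y x y = ⊑⇒≤ (y⊑x∨y x y)

  ∨-least : ∀ {x y z} → x ≤ z → y ≤ z → x ∨ y ≤ z
  ∨-least x≤z y≤z = ⊑⇒≤ (⊑-∨-least (≤⇒⊑ x≤z) (≤⇒⊑ y≤z))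

  𝟏∨x≡𝟏 : ∀ x → 𝟏 ∨ x ≡ 𝟏
  𝟏∨x≡𝟏 x = trans (∨-comm 𝟏 x) (∨-top x)

  bounded-below⇒meet : ∀ {a x y} → a ≤ x → a ≤ y → ∃[ m ] IsMeet m x y
  bounded-below⇒meet {a} {x} {y} a≤x a≤y =
    let m , _ , m≤x , m≤y , greatest = filter-meet a x y a≤x a≤y
    in m , m≤x , m≤y , λ z z≤x z≤y →
      ≤-trans (x≤x∨y z a)
        (greatest (z ∨ a) (y≤x∨y z a) (∨-least z≤x a≤x) (∨-least z≤y a≤y))

  ^⊤-sym : ∀ {x y} → x ∈ (y ^⊤) → y ∈ (x ^⊤)
  ^⊤-sym {x} {y} x∨y≡𝟏 = trans (∨-comm y x) x∨y≡𝟏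

  ^⊤-mono : ∀ {x y} → x ≤ y → (x ^⊤) ⊆ (y ^⊤)
  ^⊤-mono {x} {y} x≤y {z} z∨x≡𝟏 = begin
    z ∨ y        ≡⟨ cong (z ∨_) x≤y ⟨
    z ∨ (x ∨ y)  ≡⟨ ∨-assoc z x y ⟨
    (z ∨ x) ∨ y  ≡⟨ cong (_∨ y) z∨x≡𝟏 ⟩
    𝟏 ∨ y        ≡⟨ 𝟏∨x≡𝟏 y ⟩
    𝟏            ∎

  z∈[x∨y]^⊤⇒z∨x∈y^⊤ : ∀ {x y z} → z ∈ ((x ∨ y) ^⊤) → (z ∨ x) ∈ (y ^⊤)
  z∈[x∨y]^⊤⇒z∨x∈y^⊤ {x} {y} {z} = trans (∨-assoc z x y)

  z∨x∈x^⊤⇒z∈x^⊤ : ∀ {x z} → (z ∨ x) ∈ (x ^⊤) → z ∈ (x ^⊤)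
  z∨x∈x^⊤⇒z∈x^⊤ {x} {z} [z∨x]∨x≡𝟏 = begin
    z ∨ x        ≡⟨ cong (z ∨_) (∨-idem x) ⟨
    z ∨ (x ∨ x)  ≡⟨ ∨-assoc z x x ⟨
    (z ∨ x) ∨ x  ≡⟨ [z∨x]∨x≡𝟏 ⟩
    𝟏            ∎

  ∈-^⊤⊤ : ∀ a → a ∈ (a ^⊤⊤)
  ∈-^⊤⊤ a x = ^⊤-sym

  ^⊤∩^⊤⊤⊆｛𝟏｝ : ∀ a → (a ^⊤) ∩ (a ^⊤⊤) ⊆ ｛ 𝟏 ｝
  ^⊤∩^⊤⊤⊆｛𝟏｝ a {z} (z∈a^⊤ , z∈a^⊤⊤) = begin
    𝟏      ≡⟨ z∈a^⊤⊤ z z∈a^⊤ ⟨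
    z ∨ z  ≡⟨ ∨-idem z ⟩
    z      ∎

  𝟏∉proper-ideal : ∀ {I} → IsIdeal I → Proper I → 𝟏 ∉ I
  𝟏∉proper-ideal (down , _) proper 𝟏∈I = proper (λ x → down (∨-top x) 𝟏∈I)

  α-ideal-^⊤-closed : ∀ {I x y} → IsαIdeal I → x ∈ I → (y ^⊤) ⊆ (x ^⊤) → y ∈ I
  α-ideal-^⊤-closed {x = x} {y} (_ , α) x∈I y^⊤⊆x^⊤ =
    α y (x , x∈I , λ z z∈y^⊤ → ^⊤-sym (y^⊤⊆x^⊤ z∈y^⊤))

  a^⊤∩b^⊤⊆p^⊤⇒a∈P⊎b∈P : ∀ {P p a b} → IsPrimeIdeal P → IsαIdeal P → p ∈ P →
    (a ^⊤) ∩ (b ^⊤) ⊆ (p ^⊤) → a ∈ P ⊎ b ∈ P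
  a^⊤∩b^⊤⊆p^⊤⇒a∈P⊎b∈P {P} {p} {a} {b} ((down , _) , _ , _ , prime) P-α p∈P a^⊤∩b^⊤⊆p^⊤ =
    let d , meet@(d≤p∨a , d≤p∨b , _) = bounded-below⇒meet (x≤x∨y p a) (x≤x∨y p b)

        d^⊤⊆p^⊤ : (d ^⊤) ⊆ (p ^⊤)
        d^⊤⊆p^⊤ z∈d^⊤ = z∨x∈x^⊤⇒z∈x^⊤ (a^⊤∩b^⊤⊆p^⊤
          ( z∈[x∨y]^⊤⇒z∨x∈y^⊤ (^⊤-mono d≤p∨a z∈d^⊤)
          , z∈[x∨y]^⊤⇒z∨x∈y^⊤ (^⊤-mono d≤p∨b z∈d^⊤)))

        d∈P : d ∈ P
        d∈P = α-ideal-^⊤-closed P-α p∈P d^⊤⊆p^⊤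
    in map (down (y≤x∨y p a)) (down (y≤x∨y p b)) (prime (p ∨ a) (p ∨ b) d meet d∈P)

  a^⊤∩b^⊤⊆｛𝟏｝⇒a∈P⊎b∈P : ∀ {P a b} → IsPrimeIdeal P → IsαIdeal P →
    (a ^⊤) ∩ (b ^⊤) ⊆ ｛ 𝟏 ｝ → a ∈ P ⊎ b ∈ P
  a^⊤∩b^⊤⊆｛𝟏｝⇒a∈P⊎b∈P P-prime@(_ , (p , p∈P) , _) P-α a^⊤∩b^⊤⊆｛𝟏｝ =
    a^⊤∩b^⊤⊆p^⊤⇒a∈P⊎b∈P P-prime P-α p∈P λ z∈a^⊤∩b^⊤ →
      subst (_∈ (p ^⊤)) (a^⊤∩b^⊤⊆｛𝟏｝ z∈a^⊤∩b^⊤) (𝟏∨x≡𝟏 p)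

  Quasicomplement : Carrier → Carrier → Set ℓ
  Quasicomplement a b = (a ^⊤⊤) ≐ (b ^⊤)

  quasicomplement-∨ : ∀ {a b} → Quasicomplement a b → a ∨ b ≡ 𝟏
  quasicomplement-∨ {a} (a^⊤⊤⊆b^⊤ , _) = a^⊤⊤⊆b^⊤ (∈-^⊤⊤ a)

  quasicomplement-∩ : ∀ {a b} → Quasicomplement a b → (a ^⊤) ∩ (b ^⊤) ⊆ ｛ 𝟏 ｝
  quasicomplement-∩ {a} (_ , b^⊤⊆a^⊤⊤) (z∈a^⊤ , z∈b^⊤) =
    ^⊤∩^⊤⊤⊆｛𝟏｝ a (z∈a^⊤ , b^⊤⊆a^⊤⊤ z∈b^⊤)

  prime-α⊆proper⇒≐ : IsQuasicomplemented → ∀ {P M} → IsPrimeIdeal P → IsαIdeal P →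
    IsIdeal M → Proper M → P ⊆ M → M ≐ P
  prime-α⊆proper⇒≐ quasicomplemented {P} {M} P-prime P-α M-ideal@(_ , M-∨-closed) M-proper P⊆M =
    M⊆P , P⊆M
    where
    M⊆P : M ⊆ P
    M⊆P {a} a∈M =
      let b , a^⊤⊤≐b^⊤ = quasicomplemented a

          b∉P : b ∉ P
          b∉P b∈P = 𝟏∉proper-ideal M-ideal M-proper
            (subst M (quasicomplement-∨ a^⊤⊤≐b^⊤) (M-∨-closed a∈M (P⊆M b∈P)))
      in fromInj₁ (λ b∈P → contradiction b∈P b∉P)
           (a^⊤∩b^⊤⊆｛𝟏｝⇒a∈P⊎b∈P P-prime P-α (quasicomplement-∩ a^⊤⊤≐b^⊤))

  IsIdeal-resp-≐ : IsIdeal Respects _≐_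
  IsIdeal-resp-≐ (I⊆J , J⊆I) (down , ∨-closed) =
    (λ x≤y → I⊆J ∘ down x≤y ∘ J⊆I) ,
    (λ x∈J y∈J → I⊆J (∨-closed (J⊆I x∈J) (J⊆I y∈J)))

  IsMaximalIdeal-resp-≐ : IsMaximalIdeal Respects _≐_
  IsMaximalIdeal-resp-≐ I≐J@(I⊆J , J⊆I) (I-ideal , (x , x∈I) , I-proper , I-maximal) =
    IsIdeal-resp-≐ I≐J I-ideal ,
    (x , I⊆J x∈I) ,
    (λ J-total → I-proper (J⊆I ∘ J-total)) ,
    λ K K-ideal J⊆K →
      map₁ (λ (K⊆I , _) → I⊆J ∘ K⊆I , J⊆K) (I-maximal K K-ideal (J⊆K ∘ I⊆J))

-- Normality supplies a maximal ideal M ⊇ P; constructively it is the maximality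
-- of M that decides, for J ⊇ P, whether J = P or J = A.
theorem3p9 : ∀ {ℓ : Level} (A : DistNearlattice ℓ) →
    DistNearlattice.IsNormal A → DistNearlattice.IsQuasicomplemented A →
    ∀ (P : DistNearlattice.Subset A) →
    DistNearlattice.IsPrimeIdeal A P → DistNearlattice.IsαIdeal A P →
    DistNearlattice.IsMaximalIdeal A P
theorem3p9 A normal quasicomplemented P P-prime P-α =
  let M , M-maximal@(M-ideal , _ , M-proper , _) , P⊆M , _ = normal P P-prime
      M≐P = prime-α⊆proper⇒≐ A quasicomplemented P-prime P-α M-ideal M-proper P⊆M
  in IsMaximalIdeal-resp-≐ A M≐P M-maximal
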